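{- Let $(\langle G,m\rangle,p)$ be a framework that is minimally rigid on the $x$-variable torus $\mathcal T_x^2$. Then the edge set of $G$ is the disjoint union of the edge sets of a spanning tree of $G$ and a connected spanning map-graph of $G$.
   Context: A periodic orbit graph $\langle G,m\rangle$ is a finite directed multigraph $G=(V,E)$ (loops, parallel edges allowed) with gains $m:E\to\mathbb Z^2$; $\{v_i,v_j;m_e\}$ is an edge from $v_i$ to $v_j$ with gain $m_e$. Fix reals $y_1,y_2$, $L_x=\begin{pmatrix}x&0\\ y_1&y_2\end{pmatrix}$. For $p:V\to\mathbb R^2$, $\mathcal R_x(\langle G,m\rangle,p)$ is the $|E|\times(2|V|+1)$ matrix whose row for $e=\{v_i,v_j;m_e\}$ has $p_i-(p_j+m_eL_x)$ in the columns of $v_i$, $(p_j+m_eL_x)-p_i$ in the columns of $v_j$ (added if $i=j$), zeros in other vertex columns, and $(m_e)_x[p_i-(p_j+m_eL_x)]_x$ in the last column ($(\cdot)_x$ = first coordinate). The framework is minimally rigid on $\mathcal T_x^2$ if $|E|=2|V|-1$ and $\mathcal R_x$ has rank $2|V|-1$. A map-graph is a graph each of whose connected components contains exactly one cycle (a loop counts as a cycle). -}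

module Defs where

open import Level using (0ℓ)
import Data.Nat as N
open import Data.Nat using (ℕ; zero; suc; _∸_; _≥_)
open import Data.Integer as ℤ using (ℤ; +_; -[1+_])
open import Data.Fin using (Fin; zero; suc; inject₁; fromℕ; _≟_)
import Data.Bool
open import Data.Bool using (Bool; true; false)
open import Data.Product using (Σ; ∃; ∃-syntax; _×_; _,_; proj₁; proj₂)
open import Data.Sum using (_⊎_; inj₁; inj₂)
open import Data.Unit using (⊤; tt)
open import Relation.Nullary using (¬_; yes; no)
open import Relation.Binary.PropositionalEquality using (_≡_)
open import Relation.Binary.Structures using (IsTotalOrder)
open import Algebra.Structures using (IsCommutativeRing)
open import Function using (_⇔_)
open import Function.Definitions using (Injective)

-- The real numbers, axiomatised as a complete ordered field
-- (any model is isomorphic to ℝ).  Equality is the setoid equality _≈_.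

record Reals : Set₁ where
  infixl 6 _+_
  infixl 7 _*_
  infix 4 _≈_ _≤_
  field
    Carrier : Set
    _≈_ : Carrier → Carrier → Set
    _+_ _*_ : Carrier → Carrier → Carrier
    -_ : Carrier → Carrier
    0# 1# : Carrier
    isCommutativeRing : IsCommutativeRing _≈_ _+_ _*_ -_ 0# 1#
    nontrivial : ¬ (0# ≈ 1#)
    inverse : ∀ x → ¬ (x ≈ 0#) → ∃[ y ] (x * y ≈ 1#)
    _≤_ : Carrier → Carrier → Set
    isTotalOrder : IsTotalOrder _≈_ _≤_
    +-mono-≤ : ∀ {x y} z → x ≤ y → x + z ≤ y + z
    *-nonneg : ∀ {x y} → 0# ≤ x → 0# ≤ y → 0# ≤ x * y
    complete : (S : Carrier → Set) → ∃ S → (∃[ b ] (∀ s → S s → s ≤ b)) →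
               ∃[ u ] ((∀ s → S s → s ≤ u) × (∀ b → (∀ s → S s → s ≤ b) → u ≤ b))

module RealOps (ℝ : Reals) where
  open Reals ℝ

  _-_ : Carrier → Carrier → Carrier
  x - y = x + (- y)

  fromℕ' : ℕ → Carrier
  fromℕ' zero = 0#
  fromℕ' (suc n) = 1# + fromℕ' n

  fromℤ : ℤ → Carrier
  fromℤ (+ n) = fromℕ' n
  fromℤ -[1+ n ] = - (fromℕ' (suc n))

  Σ' : ∀ {k} → (Fin k → Carrier) → Carrier
  Σ' {zero} f = 0#
  Σ' {suc k} f = f zero + Σ' (λ i → f (suc i))

record OrbitGraph (n k : ℕ) : Set where
  field
    src tgt : Fin k → Fin n
    gain : Fin k → ℤ × ℤ

Col : ℕ → Set
Col n = (Fin n × Fin 2) ⊎ ⊤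

module Rigidity (ℝ : Reals) where
  open Reals ℝ
  open RealOps ℝ

  Point : Set
  Point = Carrier × Carrier

  coord : Point → Fin 2 → Carrier
  coord (a , b) zero = a
  coord (a , b) (suc _) = b

  -- the row vector m L_x, with L_x = [[x,0],[y1,y2]]
  mulL : Carrier → Carrier → Carrier → ℤ × ℤ → Point
  mulL x y1 y2 (a , b) = (fromℤ a * x + fromℤ b * y1 , fromℤ b * y2)

  R : ∀ {n k} → (x y1 y2 : Carrier) → OrbitGraph n k → (Fin n → Point) →
      Fin k → Col n → Carrier
  R {n} {k} x y1 y2 G p e col = entry col
    where
      open OrbitGraph G
      i = src e
      j = tgt e
      mL = mulL x y1 y2 (gain e)
      d : Point
      d = (proj₁ (p i) - (proj₁ (p j) + proj₁ mL)) , (proj₂ (p i) - (proj₂ (p j) + proj₂ mL))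
      atI : Fin n → Fin 2 → Carrier
      atI v c with v ≟ i
      ... | yes _ = coord d c
      ... | no _ = 0#
      atJ : Fin n → Fin 2 → Carrier
      atJ v c with v ≟ j
      ... | yes _ = - coord d c
      ... | no _ = 0#
      entry : Col n → Carrier
      entry (inj₁ (v , c)) = atI v c + atJ v c
      entry (inj₂ tt) = fromℤ (proj₁ (gain e)) * proj₁ d

  IndependentRows : ∀ {k C r} → (Fin k → C → Carrier) → (Fin r → Fin k) → Set
  IndependentRows {r = r} M f =
    (c : Fin r → Carrier) → (∀ col → Σ' (λ i → c i * M (f i) col) ≈ 0#) → ∀ i → c i ≈ 0#

  HasRank : ∀ {k C} → (Fin k → C → Carrier) → ℕ → Set
  HasRank {k} M r =
    (∃[ f ] (Injective _≡_ _≡_ f × IndependentRows {r = r} M f)) ×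
    ((f : Fin (suc r) → Fin k) → Injective _≡_ _≡_ f → ¬ IndependentRows M f)

  MinimallyRigid : ∀ {n k} → (x y1 y2 : Carrier) → OrbitGraph n k → (Fin n → Point) → Set
  MinimallyRigid {n} {k} x y1 y2 G p =
    (suc k ≡ 2 N.* n) × HasRank (R x y1 y2 G p) (2 N.* n ∸ 1)

-- Subgraphs given by edge subsets S : Fin k → Bool (spanning: all vertices kept).
-- Orientation is ignored for connectivity and cycles.

module _ {n k : ℕ} (G : OrbitGraph n k) where
  open OrbitGraph G

  Joins : Fin k → Fin n → Fin n → Set
  Joins e u v = (src e ≡ u × tgt e ≡ v) ⊎ (src e ≡ v × tgt e ≡ u)

  data Path (S : Fin k → Bool) : Fin n → Fin n → Set where
    here : ∀ {u} → Path S u u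
    step : ∀ {u w v} (e : Fin k) → S e ≡ true → Joins e u w → Path S w v → Path S u v

  Connected : (Fin k → Bool) → Set
  Connected S = ∀ u v → Path S u v

  -- a cycle in S: distinct edges es 0..l-1, distinct vertices vs 0..l-1,
  -- es i joins vs i and vs (i+1), with vs l = vs 0, l ≥ 1.
  -- (a loop is a cycle of length 1; two parallel edges a cycle of length 2)
  record Cycle (S : Fin k → Bool) : Set where
    field
      len : ℕ
      len≥1 : len ≥ 1
      es : Fin len → Fin k
      vs : Fin (suc len) → Fin n
      es-inS : ∀ i → S (es i) ≡ true
      es-inj : Injective _≡_ _≡_ es
      vs-inj : Injective _≡_ _≡_ (λ i → vs (inject₁ i))
      closed : vs (fromℕ len) ≡ vs zero
      joins : ∀ i → Joins (es i) (vs (inject₁ i)) (vs (suc i))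

  open Cycle

  InCycle : ∀ {S} → Cycle S → Fin k → Set
  InCycle C e = ∃[ i ] (es C i ≡ e)

  SameCycle : ∀ {S} → Cycle S → Cycle S → Set
  SameCycle C D = ∀ e → InCycle C e ⇔ InCycle D e

  CycleInComponent : ∀ {S} → Cycle S → Fin n → Set
  CycleInComponent {S} C v = Path S v (vs C zero)

  Acyclic : (Fin k → Bool) → Set
  Acyclic S = ¬ Cycle S

  SpanningTree : (Fin k → Bool) → Set
  SpanningTree S = Connected S × Acyclic S

  MapGraph : (Fin k → Bool) → Set
  MapGraph S = ∀ v → Σ (Cycle S) λ C → (CycleInComponent C v ×
                 ((D : Cycle S) → CycleInComponent D v → SameCycle C D))

  ConnectedSpanningMapGraph : (Fin k → Bool) → Set
  ConnectedSpanningMapGraph S = Connected S × MapGraph S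

module _ (ℝ : Reals) where
  open Reals ℝ
  open Rigidity ℝ

  Theorem3p3 : Set
  Theorem3p3 = {n k : ℕ} (G : OrbitGraph n k) (x y1 y2 : Carrier) (p : Fin n → Point) →
    MinimallyRigid x y1 y2 G p →
    ∃[ T ] ∃[ M ] ((∀ e → M e ≡ Data.Bool.not (T e)) ×
                   SpanningTree G T × ConnectedSpanningMapGraph G M)

{-# OPTIONS --safe #-}
module Submission where

-- The 2n - 1 rows of the rigidity matrix are independent.  Each row is the sum of its parts in the
-- x-columns, the y-columns and the lattice column, so (multilinearity of the determinant) it can be
-- replaced by one of these parts without losing independence.  Doing this for every row sorts the
-- edges into three classes.  In the two coordinate classes the rows are nonzero multiples of
-- incidence vectors, so these classes are forests with at most n - 1 edges each; the lattice column
-- leaves room for at most one further edge.  By counting, both forests are spanning trees, and the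
-- second one together with the single lattice edge is a connected map-graph.

open import Defs
open import Level using (0ℓ)
open import Algebra.Bundles using (CommutativeRing)
open import Data.Bool using (Bool; true; false; not; _∧_; if_then_else_)
open import Data.Bool.Properties using (∧-zeroʳ; ¬-not)
open import Data.Fin using (Fin; #_; zero; suc; inject₁; fromℕ; toℕ; punchOut; _≟_)
open import Data.Fin.Permutation using (permutation)
open import Data.Fin.Properties using
  ( any?; sequence; suc-injective; inject₁-injective; punchOut-injective; injective⇒≤
  ; fromℕ≢inject₁; toℕ-inject₁ )
open import Data.Maybe using (Maybe; just; nothing)
open import Data.Nat as ℕ using (ℕ; zero; suc; z≤n; s≤s)
import Data.Nat.Properties as ℕ
open import Data.Nat.Solver using (module +-*-Solver)
open import Data.Product using (∃-syntax; Σ-syntax; _×_; _,_; proj₁; proj₂)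
open import Data.Sum using (_⊎_; inj₁; inj₂; swap)
open import Data.Unit using (tt)
open import Data.Vec using (Vec; []; _∷_; lookup; map; replicate; _[_]≔_)
open import Data.Vec.Properties using (lookup-map; lookup∘update; lookup∘update′; lookup-replicate)
open import Effect.Monad using (RawMonad)
open import Function using (_∘_; id; mk⇔; case_of_)
open import Function.Definitions using (Injective)
import Relation.Binary.PropositionalEquality as ≡
open ≡ using (_≡_; _≢_)
open import Relation.Binary.Structures using (IsTotalOrder)
open import Relation.Nullary using (¬_; Dec; yes; no; does; contradiction)
open import Relation.Nullary.Decidable using (dec-true; dec-false)
open import Relation.Nullary.Negation using (¬¬-Monad)

-- Edge sets

private
  variable
    n k : ℕ

infix 4 _⊆_
_⊆_ : (P Q : Fin k → Bool) → Set
P ⊆ Q = ∀ e → P e ≡ true → Q e ≡ true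

infixl 6 _∖_
_∖_ : (Fin k → Bool) → Fin k → Fin k → Bool
(S ∖ f) e = S e ∧ not (does (e ≟ f))

∖-self : (S : Fin k → Bool) (f : Fin k) → (S ∖ f) f ≡ false
∖-self S f with f ≟ f
... | yes _ = ∧-zeroʳ (S f)
... | no f≢f = contradiction ≡.refl f≢f

∖-⊆ : (S : Fin k → Bool) (f : Fin k) → S ∖ f ⊆ S
∖-⊆ S f e e∈ with S e
... | true = ≡.refl

∈∖⇒≢ : (S : Fin k → Bool) {e f : Fin k} → (S ∖ f) e ≡ true → e ≢ f
∈∖⇒≢ S {e} e∈ ≡.refl = case ≡.trans (≡.sym e∈) (∖-self S e) of λ ()

∈∖ : (S : Fin k → Bool) {e f : Fin k} → S e ≡ true → e ≢ f → (S ∖ f) e ≡ true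
∈∖ S {e} {f} e∈S e≢f with e ≟ f
... | yes e≡f = contradiction e≡f e≢f
... | no _ rewrite e∈S = ≡.refl

count : (Fin k → Bool) → ℕ
count {zero} S = 0
count {suc k} S = (if S zero then 1 else 0) ℕ.+ count (S ∘ suc)

count-member : (S : Fin k → Bool) → 1 ℕ.≤ count S → ∃[ e ] S e ≡ true
count-member {suc k} S 1≤ with S zero in eq
... | true = zero , eq
... | false with count-member (S ∘ suc) 1≤
...   | e , e∈S = suc e , e∈S

count-empty : (S : Fin k → Bool) → (∀ e → S e ≢ true) → count S ≡ 0
count-empty {zero} S _ = ≡.refl
count-empty {suc k} S empty with S zero in eq
... | true = contradiction eq (empty zero)
... | false = count-empty (S ∘ suc) (empty ∘ suc)

count-≤1 : (S : Fin k → Bool) → (∀ e f → S e ≡ true → S f ≡ true → e ≡ f) → count S ℕ.≤ 1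
count-≤1 {zero} S _ = z≤n
count-≤1 {suc k} S unique with S zero in eq
... | true = ℕ.≤-reflexive (≡.cong suc (count-empty (S ∘ suc)
               λ e e∈S → case unique zero (suc e) eq e∈S of λ ()))
... | false = count-≤1 (S ∘ suc) λ e f p q → suc-injective (unique (suc e) (suc f) p q)

-- Walks and forests

module _ {n k : ℕ} (G : OrbitGraph n k) where
  open OrbitGraph G

  path-++ : ∀ {P u v w} → Path G P u v → Path G P v w → Path G P u w
  path-++ here q = q
  path-++ (step e e∈P j p) q = step e e∈P j (path-++ p q)

  path-sym : ∀ {P u v} → Path G P u v → Path G P v u
  path-sym here = here
  path-sym (step e e∈P j p) = path-++ (path-sym p) (step e e∈P (swap j) here)

  path-bind : ∀ {P Q u v} → (∀ {e a b} → P e ≡ true → Joins G e a b → Path G Q a b) →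
              Path G P u v → Path G Q u v
  path-bind φ here = here
  path-bind φ (step e e∈P j p) = path-++ (φ e∈P j) (path-bind φ p)

  path-mono : ∀ {P Q u v} → P ⊆ Q → Path G P u v → Path G Q u v
  path-mono P⊆Q = path-bind λ {e} e∈P j → step e (P⊆Q e e∈P) j here

  -- `Joins` fixes the ends of an edge only up to order, so the walk may have to be reversed.
  path-between-ends : ∀ {P e a b u v} → Joins G e a b → Joins G e u v → Path G P a b → Path G P u v
  path-between-ends (inj₁ (≡.refl , ≡.refl)) (inj₁ (≡.refl , ≡.refl)) p = p
  path-between-ends (inj₁ (≡.refl , ≡.refl)) (inj₂ (≡.refl , ≡.refl)) p = path-sym p
  path-between-ends (inj₂ (≡.refl , ≡.refl)) (inj₁ (≡.refl , ≡.refl)) p = path-sym p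
  path-between-ends (inj₂ (≡.refl , ≡.refl)) (inj₂ (≡.refl , ≡.refl)) p = p

  -- Acyclicity phrased with walks: no edge of S is bypassed by a walk in the rest of S.
  Forest : (Fin k → Bool) → Set
  Forest S = ∀ e (P : Fin k → Bool) → S e ≡ true → P e ≡ false → P ⊆ S → ¬ Path G P (src e) (tgt e)

  forest-no-bypass : ∀ {S e u v} → Forest S → S e ≡ true → Joins G e u v → ¬ Path G (S ∖ e) u v
  forest-no-bypass {S} {e} forest e∈S j p =
    forest e (S ∖ e) e∈S (∖-self S e) (∖-⊆ S e) (path-between-ends j (inj₁ (≡.refl , ≡.refl)) p)

-- Counting the components of a forest

dropEdge : OrbitGraph n (suc k) → OrbitGraph n k
dropEdge G = record { src = src ∘ suc ; tgt = tgt ∘ suc ; gain = gain ∘ suc }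
  where open OrbitGraph G

path-lift : (G : OrbitGraph n (suc k)) {P : Fin k → Bool} {Q : Fin (suc k) → Bool} {u v : Fin n} →
            P ⊆ Q ∘ suc → Path (dropEdge G) P u v → Path G Q u v
path-lift G P⊆Q here = here
path-lift G P⊆Q (step e e∈P j p) = step (suc e) (P⊆Q e e∈P) j (path-lift G P⊆Q p)

addFalse : (Fin k → Bool) → Fin (suc k) → Bool
addFalse P zero = false
addFalse P (suc e) = P e

-- Because `Forest` quantifies over all `P`, a bypass in the smaller graph lifts directly, with
-- `addFalse P` as the new edge set.
forest-drop : (G : OrbitGraph n (suc k)) {S : Fin (suc k) → Bool} →
              Forest G S → Forest (dropEdge G) (S ∘ suc)
forest-drop G forest e P e∈S e∉P P⊆S p =
  forest (suc e) (addFalse P) e∈S e∉P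
    (λ { (suc e) → P⊆S e }) (path-lift G (λ _ e∈P → e∈P) p)

-- The quotient map gluing `b` to `a`: the label `b` is punched out and sent where `a` goes.
merge : (a b : Fin (suc n)) → b ≢ a → Fin (suc n) → Fin n
merge a b b≢a x with b ≟ x
... | yes _ = punchOut b≢a
... | no b≢x = punchOut b≢x

merge-fibres : {a b : Fin (suc n)} (b≢a : b ≢ a) {x y : Fin (suc n)} → merge a b b≢a x ≡ merge a b b≢a y →
               x ≡ y ⊎ (x ≡ a × y ≡ b) ⊎ (x ≡ b × y ≡ a)
merge-fibres {b = b} b≢a {x} {y} eq with b ≟ x | b ≟ y
... | yes ≡.refl | yes ≡.refl = inj₁ ≡.refl
... | yes ≡.refl | no b≢y = inj₂ (inj₂ (≡.refl , ≡.sym (punchOut-injective b≢a b≢y eq)))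
... | no b≢x | yes ≡.refl = inj₂ (inj₁ (punchOut-injective b≢x b≢a eq , ≡.refl))
... | no b≢x | no b≢y = inj₁ (punchOut-injective b≢x b≢y eq)

-- Only connected vertices may share a label, so `m` bounds the number of components from above. The
-- equation is Euler's formula for forests; a single label means that all vertices are connected.
Components : (G : OrbitGraph n k) → (Fin k → Bool) → Set
Components {n} G S =
  ∃[ m ] Σ[ f ∈ (Fin n → Fin m) ] (m ℕ.+ count S ≡ n × (∀ {u v} → f u ≡ f v → Path G S u v))

-- Induction on the edges. If edge `zero` is in the forest, its ends carry different labels, since
-- equal labels would give a walk bypassing it; merging the two labels trades one label for one
-- edge.
forest-components : (G : OrbitGraph n k) (S : Fin k → Bool) → Forest G S → Components G S
forest-components {n} {zero} G S _ = n , (λ v → v) , ℕ.+-identityʳ n , λ { ≡.refl → here }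
forest-components {n} {suc k} G S forest
  with forest-components (dropEdge G) (S ∘ suc) (forest-drop G forest) | S zero in eq
... | m , f , size , conn | false = m , f , size , λ p → path-lift G (λ _ e∈S → e∈S) (conn p)
... | zero , f , size , conn | true = case f (OrbitGraph.src G zero) of λ ()
... | suc m , f , size , conn | true = m , merge a b b≢a ∘ f , ≡.trans (ℕ.+-suc m _) size , conn′
  where
  open OrbitGraph G
  a b : Fin (suc m)
  a = f (src zero)
  b = f (tgt zero)
  lift : ∀ {u v} → f u ≡ f v → Path G S u v
  lift p = path-lift G (λ _ e∈S → e∈S) (conn p)
  b≢a : b ≢ a
  b≢a b≡a = forest zero (addFalse (S ∘ suc)) eq ≡.refl (λ { (suc e) e∈S → e∈S })
    (path-lift G (λ _ e∈S → e∈S) (conn (≡.sym b≡a)))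
  bridge : Path G S (src zero) (tgt zero)
  bridge = step zero eq (inj₁ (≡.refl , ≡.refl)) here
  conn′ : ∀ {u v} → merge a b b≢a (f u) ≡ merge a b b≢a (f v) → Path G S u v
  conn′ p with merge-fibres b≢a p
  ... | inj₁ u~v = lift u~v
  ... | inj₂ (inj₁ (u~a , v~b)) = path-++ G (lift u~a) (path-++ G bridge (lift (≡.sym v~b)))
  ... | inj₂ (inj₂ (u~b , v~a)) = path-++ G (lift u~b) (path-++ G (path-sym G bridge) (lift (≡.sym v~a)))

-- Cycles

module _ {n k : ℕ} (G : OrbitGraph n k) where
  open Cycle

  IsWalk : ∀ {l} → (Fin l → Fin k) → (Fin (suc l) → Fin n) → Set
  IsWalk es vs = ∀ i → Joins G (es i) (vs (inject₁ i)) (vs (suc i))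

  walk-path : ∀ {l P} {es : Fin l → Fin k} {vs} → IsWalk es vs → (∀ j → P (es j) ≡ true) →
              Path G P (vs zero) (vs (fromℕ l))
  walk-path {zero} joins ∈P = here
  walk-path {suc l} {vs = vs} joins ∈P =
    step _ (∈P zero) (joins zero) (walk-path {vs = vs ∘ suc} (joins ∘ suc) (∈P ∘ suc))

  walk-before : ∀ {l P} {es : Fin l → Fin k} {vs} → IsWalk es vs → (i : Fin l) →
                (∀ j → j ≢ i → P (es j) ≡ true) → Path G P (vs zero) (vs (inject₁ i))
  walk-before joins zero ∈P = here
  walk-before {vs = vs} joins (suc i) ∈P =
    step _ (∈P zero λ ()) (joins zero)
      (walk-before {vs = vs ∘ suc} (joins ∘ suc) i λ j j≢i → ∈P (suc j) (j≢i ∘ suc-injective))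

  walk-after : ∀ {l P} {es : Fin l → Fin k} {vs} → IsWalk es vs → (i : Fin l) →
               (∀ j → j ≢ i → P (es j) ≡ true) → Path G P (vs (suc i)) (vs (fromℕ l))
  walk-after {vs = vs} joins zero ∈P = walk-path {vs = vs ∘ suc} (joins ∘ suc) λ j → ∈P (suc j) λ ()
  walk-after {vs = vs} joins (suc i) ∈P =
    walk-after {vs = vs ∘ suc} (joins ∘ suc) i λ j j≢i → ∈P (suc j) (j≢i ∘ suc-injective)

  -- Walk on from the far end of edge `i` to the closing vertex, then from the start of the cycle to
  -- the near end, and reverse the result.
  cycle-bypass : ∀ {S P} (C : Cycle G S) (i : Fin (len C)) → (∀ j → j ≢ i → P (es C j) ≡ true) →
                 Path G P (vs C (inject₁ i)) (vs C (suc i))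
  cycle-bypass {P = P} C i ∈P = path-sym G
    (path-++ G (≡.subst (Path G P _) (closed C) (walk-after {vs = vs C} (joins C) i ∈P))
               (walk-before {vs = vs C} (joins C) i ∈P))

  firstEdge : ∀ {S} (C : Cycle G S) → Fin (len C)
  firstEdge C with len C | len≥1 C
  ... | suc _ | _ = zero

  -- The rest of a cycle bypasses its first edge; `es-inj` keeps that edge out of the rest.
  forest-acyclic : ∀ {S} → Forest G S → Acyclic G S
  forest-acyclic {S} forest C = forest-no-bypass G forest (es-inS C i) (joins C i)
    (cycle-bypass C i λ j j≢i → ∈∖ S (es-inS C j) (j≢i ∘ es-inj C))
    where i = firstEdge C

  -- Simple paths and the cycles they close

  record SimplePath (P : Fin k → Bool) (u v : Fin n) (l : ℕ) : Set where
    field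
      edges : Fin l → Fin k
      verts : Fin (suc l) → Fin n
      starts : verts zero ≡ u
      ends : verts (fromℕ l) ≡ v
      edges∈ : ∀ i → P (edges i) ≡ true
      verts-inj : Injective _≡_ _≡_ verts
      walk : IsWalk edges verts

    -- Two steps along one edge have the same pair of ends. In the same order, distinctness of
    -- vertices gives `i ≡ j`; in opposite order it would give both `i = j + 1` and `j = i + 1`.
    edges-inj : Injective _≡_ _≡_ edges
    edges-inj {i} {j} eq with walk i | walk j
    ... | w | w′ rewrite eq = sameEnds w w′
      where
      forwards : verts (inject₁ i) ≡ verts (inject₁ j) → i ≡ j
      forwards p = inject₁-injective (verts-inj p)
      backwards : verts (inject₁ i) ≡ verts (suc j) → verts (suc i) ≡ verts (inject₁ j) → i ≡ j
      backwards p q = contradiction (ℕ.≤-reflexive 1+i≡j) (ℕ.<⇒≯ (ℕ.≤-reflexive (≡.sym i≡1+j)))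
        where
        i≡1+j : toℕ i ≡ suc (toℕ j)
        i≡1+j = ≡.trans (≡.sym (toℕ-inject₁ i)) (≡.cong toℕ (verts-inj p))
        1+i≡j : suc (toℕ i) ≡ toℕ j
        1+i≡j = ≡.trans (≡.cong toℕ (verts-inj q)) (toℕ-inject₁ j)
      sameEnds : ∀ {e} → Joins G e (verts (inject₁ i)) (verts (suc i)) →
                 Joins G e (verts (inject₁ j)) (verts (suc j)) → i ≡ j
      sameEnds (inj₁ (p , _)) (inj₁ (q , _)) = forwards (≡.trans (≡.sym p) q)
      sameEnds (inj₁ (p , p′)) (inj₂ (q , q′)) = backwards (≡.trans (≡.sym p) q) (≡.trans (≡.sym p′) q′)
      sameEnds (inj₂ (p , p′)) (inj₁ (q , q′)) = backwards (≡.trans (≡.sym p′) q′) (≡.trans (≡.sym p) q)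
      sameEnds (inj₂ (_ , p)) (inj₂ (_ , q)) = forwards (≡.trans (≡.sym p) q)

  open SimplePath

  suffix : ∀ {P u v l} (p : SimplePath P u v l) (i : Fin (suc l)) → ∃[ l′ ] SimplePath P (verts p i) v l′
  suffix {l = l} p zero = l , record
    { edges = edges p ; verts = verts p ; starts = ≡.refl ; ends = ends p
    ; edges∈ = edges∈ p ; verts-inj = verts-inj p ; walk = walk p }
  suffix {l = suc l} p (suc i) = suffix tailPath i
    where
    tailPath = record
      { edges = edges p ∘ suc ; verts = verts p ∘ suc ; starts = ≡.refl ; ends = ends p
      ; edges∈ = edges∈ p ∘ suc ; verts-inj = suc-injective ∘ verts-inj p ; walk = walk p ∘ suc }

  cons : ∀ {P u w v l e} → P e ≡ true → Joins G e u w → (p : SimplePath P w v l) →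
         (∀ i → verts p i ≢ u) → SimplePath P u v (suc l)
  cons {u = u} {l = l} {e = e} e∈P j p fresh = record
    { edges = edges′ ; verts = verts′ ; starts = ≡.refl ; ends = ends p
    ; edges∈ = λ { zero → e∈P ; (suc i) → edges∈ p i }
    ; verts-inj = inj
    ; walk = λ { zero → ≡.subst (Joins G e u) (≡.sym (starts p)) j ; (suc i) → walk p i } }
    where
    edges′ : Fin (suc l) → Fin k
    edges′ zero = e
    edges′ (suc i) = edges p i
    verts′ : Fin (suc (suc l)) → Fin n
    verts′ zero = u
    verts′ (suc i) = verts p i
    inj : Injective _≡_ _≡_ verts′
    inj {zero} {zero} _ = ≡.refl
    inj {zero} {suc j} eq = contradiction (≡.sym eq) (fresh j)
    inj {suc i} {zero} eq = contradiction eq (fresh i)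
    inj {suc i} {suc j} eq = ≡.cong suc (verts-inj p eq)

  -- Loop erasure: if the start already occurs on the simplified tail, everything before that
  -- occurrence is discarded.
  simplify : ∀ {P u v} → Path G P u v → ∃[ l ] SimplePath P u v l
  simplify {u = u} here = 0 , record
    { edges = λ () ; verts = λ _ → u ; starts = ≡.refl ; ends = ≡.refl
    ; edges∈ = λ () ; verts-inj = λ { {zero} {zero} _ → ≡.refl } ; walk = λ () }
  simplify {P} {u} {v} (step e e∈P j p) with simplify p
  ... | l , q with any? (λ i → verts q i ≟ u)
  ...   | yes (i , qi≡u) = ≡.subst (λ w → ∃[ l ] SimplePath P w v l) qi≡u (suffix q i)
  ...   | no fresh = suc l , cons e∈P j q λ i eq → fresh (i , eq)

  -- The closing edge comes first, from `v` to `u`, so the vertex list starts at `v` and ends with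
  -- the last vertex of the path, again `v`. For `l = 0` the cycle is a loop.
  closePath : ∀ {P S u v l e} → SimplePath P u v l → P ⊆ S → S e ≡ true → P e ≡ false → Joins G e v u → Cycle G S
  closePath {P} {S} {u} {v} {l} {e} p P⊆S e∈S e∉P j = record
    { len = suc l ; len≥1 = s≤s z≤n ; es = es′ ; vs = vs′
    ; es-inS = λ { zero → e∈S ; (suc i) → P⊆S _ (edges∈ p i) }
    ; es-inj = es-inj′ ; vs-inj = vs-inj′ ; closed = ends p
    ; joins = λ { zero → ≡.subst (Joins G e v) (≡.sym (starts p)) j ; (suc i) → walk p i } }
    where
    es′ : Fin (suc l) → Fin k
    es′ zero = e
    es′ (suc i) = edges p i
    vs′ : Fin (suc (suc l)) → Fin n
    vs′ zero = v
    vs′ (suc i) = verts p i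
    e-new : ∀ i → e ≢ edges p i
    e-new i ≡.refl = case ≡.trans (≡.sym e∉P) (edges∈ p i) of λ ()
    v-last : ∀ i → v ≢ verts p (inject₁ i)
    v-last i eq = fromℕ≢inject₁ (verts-inj p (≡.trans (ends p) eq))
    es-inj′ : Injective _≡_ _≡_ es′
    es-inj′ {zero} {zero} _ = ≡.refl
    es-inj′ {zero} {suc j} eq = contradiction eq (e-new j)
    es-inj′ {suc i} {zero} eq = contradiction (≡.sym eq) (e-new i)
    es-inj′ {suc i} {suc j} eq = ≡.cong suc (edges-inj p eq)
    vs-inj′ : Injective _≡_ _≡_ (vs′ ∘ inject₁)
    vs-inj′ {zero} {zero} _ = ≡.refl
    vs-inj′ {zero} {suc j} eq = contradiction eq (v-last j)
    vs-inj′ {suc i} {zero} eq = contradiction (≡.sym eq) (v-last i)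
    vs-inj′ {suc i} {suc j} eq = ≡.cong suc (inject₁-injective (verts-inj p eq))

  -- A spanning tree plus one edge

  module _ {B M : Fin k → Bool} {e₀ : Fin k} (forest : Forest G B) (conn : Connected G B)
           (B⊆M : B ⊆ M) (e₀∈M : M e₀ ≡ true) (e₀∉B : B e₀ ≡ false)
           (M⊆B+e₀ : ∀ e → M e ≡ true → e ≢ e₀ → B e ≡ true) where

    -- A cycle avoiding `e₀` would lie in the forest `B`.
    e₀∈cycle : (C : Cycle G M) → InCycle G C e₀
    e₀∈cycle C with any? (λ i → es C i ≟ e₀)
    ... | yes e₀∈C = e₀∈C
    ... | no e₀∉C = contradiction cycleInB (forest-acyclic forest)
      where
      cycleInB : Cycle G B
      cycleInB = record
        { len = len C ; len≥1 = len≥1 C ; es = es C ; vs = vs C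
        ; es-inS = λ i → M⊆B+e₀ _ (es-inS C i) λ eq → e₀∉C (i , eq)
        ; es-inj = es-inj C ; vs-inj = vs-inj C ; closed = closed C ; joins = joins C }

    -- If f ∈ C avoided D, replacing e₀ in C - f by D - e₀ would bypass f inside B.
    cycle-⊆ : (C D : Cycle G M) (f : Fin k) → InCycle G C f → InCycle G D f
    cycle-⊆ C D f (i , Ci≡f) with f ≟ e₀ | any? (λ j → es D j ≟ f) | e₀∈cycle D
    ... | yes ≡.refl | _ | e₀∈D = e₀∈D
    ... | no _ | yes f∈D | _ = f∈D
    ... | no f≢e₀ | no f∉D | d , Dd≡e₀ = contradiction bypass (forest-no-bypass G forest f∈B f-joins)
      where
      f-joins : Joins G f (vs C (inject₁ i)) (vs C (suc i))
      f-joins = ≡.subst (λ e → Joins G e _ _) Ci≡f (joins C i)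
      f∈B : B f ≡ true
      f∈B = M⊆B+e₀ f (≡.subst (λ e → M e ≡ true) Ci≡f (es-inS C i)) f≢e₀
      e₀-joins : Joins G e₀ (vs D (inject₁ d)) (vs D (suc d))
      e₀-joins = ≡.subst (λ e → Joins G e _ _) Dd≡e₀ (joins D d)
      detour : Path G (B ∖ f) (vs D (inject₁ d)) (vs D (suc d))
      detour = cycle-bypass D d λ j j≢d → ∈∖ B
        (M⊆B+e₀ _ (es-inS D j) λ eq → j≢d (es-inj D (≡.trans eq (≡.sym Dd≡e₀)))) (λ eq → f∉D (j , eq))
      reroute : ∀ {e a b} → (M ∖ f) e ≡ true → Joins G e a b → Path G (B ∖ f) a b
      reroute {e} e∈ j with e ≟ e₀
      ... | yes ≡.refl = path-between-ends G e₀-joins j detour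
      ... | no e≢e₀ = step e (∈∖ B (M⊆B+e₀ e (∖-⊆ M f e e∈) e≢e₀) (∈∖⇒≢ M e∈)) j here
      bypass : Path G (B ∖ f) (vs C (inject₁ i)) (vs C (suc i))
      bypass = path-bind G reroute (cycle-bypass C i λ j j≢i →
        ∈∖ M (es-inS C j) λ eq → j≢i (es-inj C (≡.trans eq (≡.sym Ci≡f))))

    -- The fundamental cycle of `e₀`, its tree path closed by `e₀` itself, serves every vertex;
    -- `cycle-⊆` in both directions gives uniqueness.
    tree+edge-mapGraph : ConnectedSpanningMapGraph G M
    tree+edge-mapGraph = connM , λ v →
      cycle , connM v _ , λ D _ f → mk⇔ (cycle-⊆ cycle D f) (cycle-⊆ D cycle f)
      where
      open OrbitGraph G
      connM : Connected G M
      connM u v = path-mono G B⊆M (conn u v)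
      cycle : Cycle G M
      cycle with simplify (conn (tgt e₀) (src e₀))
      ... | l , p = closePath p B⊆M e₀∈M e₀∉B (inj₁ (≡.refl , ≡.refl))

-- Punching out a missed value would inject `Fin (suc k)` into `Fin k`.
injective⇒surjective : ∀ {k} {π : Fin k → Fin k} → Injective _≡_ _≡_ π → ∀ i → ∃[ j ] π j ≡ i
injective⇒surjective {suc k} {π} inj i with any? (λ j → π j ≟ i)
... | yes j = j
... | no ∄j = contradiction (injective⇒≤ (inj ∘ punchOut-injective (i≢π _) (i≢π _))) ℕ.1+n≰n
  where
  i≢π : ∀ j → i ≢ π j
  i≢π j eq = ∄j (j , ≡.sym eq)

-- Consequences of completeness

module RealFacts (ℝ : Reals) where
  open Reals ℝ
  open RealOps ℝ

  commutativeRing : CommutativeRing 0ℓ 0ℓ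
  commutativeRing = record { isCommutativeRing = isCommutativeRing }

  open CommutativeRing commutativeRing public using
    ( setoid; refl; sym; trans; reflexive; semiring; ring; +-abelianGroup
    ; +-cong; +-congˡ; +-congʳ; +-assoc; +-identityˡ; +-identityʳ; -‿cong; -‿inverseˡ; -‿inverseʳ
    ; *-congˡ; *-congʳ; *-assoc; *-comm; *-identityˡ; *-identityʳ; zeroˡ; zeroʳ; distribʳ )
  open IsTotalOrder isTotalOrder using (total; antisym) renaming (trans to ≤-trans; reflexive to ≤-reflexive)
  open import Relation.Binary.Reasoning.Setoid setoid
  open import Algebra.Properties.Ring ring public using (-1*x≈-x; x[y-z]≈xy-xz; -‿distribˡ-*; -‿involutive; -0#≈0#)
  open import Algebra.Properties.AbelianGroup +-abelianGroup public using (xyx⁻¹≈y; ⁻¹-anti-homo‿-)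
  import Algebra.Properties.Semiring.Sum semiring as Sum

  _≤≈_ : ∀ {x y z} → x ≤ y → y ≈ z → x ≤ z
  p ≤≈ q = ≤-trans p (≤-reflexive q)

  _≈≤_ : ∀ {x y z} → x ≈ y → y ≤ z → x ≤ z
  p ≈≤ q = ≤-trans (≤-reflexive p) q

  -- If 1 ≤ 0, then -1 is nonnegative, hence so is its square 1, and antisymmetry gives 0 = 1.
  1≰0 : ¬ (1# ≤ 0#)
  1≰0 1≤0 = nontrivial (antisym 0≤1 1≤0)
    where
    0≤-1 : 0# ≤ - 1#
    0≤-1 = (sym (-‿inverseʳ 1#) ≈≤ +-mono-≤ (- 1#) 1≤0) ≤≈ +-identityˡ _
    0≤1 : 0# ≤ 1#
    0≤1 = *-nonneg 0≤-1 0≤-1 ≤≈ trans (-1*x≈-x (- 1#)) (-‿involutive 1#)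

  x+y≤z⇒y≤z-x : ∀ x {y z} → x + y ≤ z → y ≤ z - x
  x+y≤z⇒y≤z-x x {y} p = sym (xyx⁻¹≈y x y) ≈≤ +-mono-≤ (- x) p

  z≤z-x⇒x≤0 : ∀ x {z} → z ≤ z - x → x ≤ 0#
  z≤z-x⇒x≤0 x {z} p = (sym (+-identityˡ x) ≈≤ +-mono-≤ x 0≤-x) ≤≈ -‿inverseˡ x
    where
    0≤-x : 0# ≤ - x
    0≤-x = (sym (-‿inverseʳ z) ≈≤ +-mono-≤ (- z) p) ≤≈ xyx⁻¹≈y z (- x)

  1+1≰1 : ¬ (1# + 1# ≤ 1#)
  1+1≰1 p = 1≰0 (z≤z-x⇒x≤0 1# (x+y≤z⇒y≤z-x 1# p))

  -- The supremum of {0} ∪ {2 | P}, compared with 1, decides between ¬ P and ¬ ¬ P.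
  wlem : (P : Set) → ¬ P ⊎ ¬ ¬ P
  wlem P with complete S (0# , inj₁ refl) (1# + 1# , bounded)
    where
    S : Carrier → Set
    S s = s ≈ 0# ⊎ (s ≈ 1# + 1# × P)
    0≤2 : 0# ≤ 1# + 1#
    0≤2 with total 0# 1#
    ... | inj₂ 1≤0 = contradiction 1≤0 1≰0
    ... | inj₁ 0≤1 = ≤-trans 0≤1 (sym (+-identityˡ 1#) ≈≤ +-mono-≤ 1# 0≤1)
    bounded : ∀ s → S s → s ≤ 1# + 1#
    bounded s (inj₁ s≈0) = s≈0 ≈≤ 0≤2
    bounded s (inj₂ (s≈2 , _)) = ≤-reflexive s≈2
  ... | u , upper , least with total u 1#
  ...   | inj₁ u≤1 = inj₁ λ p → 1+1≰1 (≤-trans (upper _ (inj₂ (refl , p))) u≤1)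
  ...   | inj₂ 1≤u = inj₂ λ ¬p → 1≰0 (≤-trans 1≤u (least 0# λ
            { s (inj₁ s≈0) → ≤-reflexive s≈0
            ; s (inj₂ (_ , p)) → contradiction p ¬p }))

  -- The set of s with ¬ ¬ (s ≤ 0) is bounded and closed under addition, so its elements are ≤ 0.
  ≤0-stable : ∀ {x} → ¬ ¬ (x ≤ 0#) → x ≤ 0#
  ≤0-stable {x} x∈S with complete S (x , x∈S) (1# , bounded)
    where
    S : Carrier → Set
    S s = ¬ ¬ (s ≤ 0#)
    bounded : ∀ s → S s → s ≤ 1#
    bounded s s∈S with total s 1#
    ... | inj₁ s≤1 = s≤1
    ... | inj₂ 1≤s = contradiction (λ s≤0 → 1≰0 (≤-trans 1≤s s≤0)) s∈S
  -- Translation by `x` maps `S` into itself, so `u - x` is again an upper bound; leastness gives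
  -- `u ≤ u - x`.
  ... | u , upper , least = z≤z-x⇒x≤0 x (least (u - x) λ s s∈S →
    x+y≤z⇒y≤z-x x (upper (x + s) λ ¬p → x∈S λ x≤0 → s∈S λ s≤0 →
      ¬p (≤-trans (+-mono-≤ s x≤0) (+-identityˡ s ≈≤ s≤0))))

  -- Permits proofs by contradiction that a coefficient vanishes, although equality of reals is not
  -- assumed decidable.
  ≈0-stable : ∀ {x} → ¬ ¬ (x ≈ 0#) → x ≈ 0#
  ≈0-stable {x} ¬¬x≈0 = antisym
    (≤0-stable λ ¬p → ¬¬x≈0 λ x≈0 → ¬p (≤-reflexive x≈0))
    ((sym (-‿inverseˡ x) ≈≤ +-mono-≤ x -x≤0) ≤≈ +-identityˡ x)
    where
    -x≤0 : - x ≤ 0#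
    -x≤0 = ≤0-stable λ ¬p → ¬¬x≈0 λ x≈0 → ¬p (≤-reflexive (trans (-‿cong x≈0) -0#≈0#))

  -- Finite sums

  Σ'≡sum : ∀ {k} (f : Fin k → Carrier) → Σ' f ≡ Sum.sum f
  Σ'≡sum {zero} f = ≡.refl
  Σ'≡sum {suc k} f = ≡.cong (f zero +_) (Σ'≡sum (f ∘ suc))

  Σ-cong : ∀ {k} {f g : Fin k → Carrier} → (∀ i → f i ≈ g i) → Σ' f ≈ Σ' g
  Σ-cong {zero} p = refl
  Σ-cong {suc k} p = +-cong (p zero) (Σ-cong (p ∘ suc))

  Σ-zero : ∀ {k} {f : Fin k → Carrier} → (∀ i → f i ≈ 0#) → Σ' f ≈ 0#
  Σ-zero {zero} p = refl
  Σ-zero {suc k} p = trans (+-cong (p zero) (Σ-zero (p ∘ suc))) (+-identityˡ 0#)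

  Σ-+ : ∀ {k} (f g : Fin k → Carrier) → Σ' (λ i → f i + g i) ≈ Σ' f + Σ' g
  Σ-+ f g rewrite Σ'≡sum (λ i → f i + g i) | Σ'≡sum f | Σ'≡sum g = Sum.∑-distrib-+ f g

  Σ-*ˡ : ∀ {k} x (f : Fin k → Carrier) → Σ' (λ i → x * f i) ≈ x * Σ' f
  Σ-*ˡ x f rewrite Σ'≡sum (λ i → x * f i) | Σ'≡sum f = sym (Sum.*-distribˡ-sum x f)

  Σ-*ʳ : ∀ {k} x (f : Fin k → Carrier) → Σ' (λ i → f i * x) ≈ Σ' f * x
  Σ-*ʳ x f rewrite Σ'≡sum (λ i → f i * x) | Σ'≡sum f = sym (Sum.*-distribʳ-sum x f)

  Σ-comm : ∀ {k m} (f : Fin k → Fin m → Carrier) →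
           Σ' (λ i → Σ' (λ j → f i j)) ≈ Σ' (λ j → Σ' (λ i → f i j))
  Σ-comm {k} {m} f = begin
    Σ' (λ i → Σ' (f i))                  ≈⟨ Σ-cong (λ i → reflexive (Σ'≡sum (f i))) ⟩
    Σ' (λ i → Sum.sum (f i))             ≡⟨ Σ'≡sum {k} _ ⟩
    Sum.sum (λ i → Sum.sum (f i))        ≈⟨ Sum.∑-comm f ⟩
    Sum.sum (λ j → Sum.sum (λ i → f i j)) ≡⟨ Σ'≡sum {m} _ ⟨
    Σ' (λ j → Sum.sum (λ i → f i j))     ≈⟨ Σ-cong (λ j → reflexive (Σ'≡sum (λ i → f i j))) ⟨
    Σ' (λ j → Σ' (λ i → f i j))          ∎

  Σ-permute : ∀ {k} (f : Fin k → Carrier) {π : Fin k → Fin k} → Injective _≡_ _≡_ π → Σ' f ≈ Σ' (f ∘ π)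
  Σ-permute {k} f {π} π-inj rewrite Σ'≡sum f | Σ'≡sum (f ∘ π) =
    Sum.sum-permute f (permutation π π⁻¹ (proj₂ ∘ surj) λ i → π-inj (proj₂ (surj (π i))))
    where
    surj : ∀ i → ∃[ j ] π j ≡ i
    surj = injective⇒surjective π-inj
    π⁻¹ : Fin k → Fin k
    π⁻¹ = proj₁ ∘ surj

  -- Kronecker delta

  δ : ∀ {k} → Fin k → Fin k → Carrier
  δ i j = if does (i ≟ j) then 1# else 0#

  δ-refl : ∀ {k} (i : Fin k) → δ i i ≈ 1#
  δ-refl i rewrite dec-true (i ≟ i) ≡.refl = refl

  δ-≢ : ∀ {k} {i j : Fin k} → i ≢ j → δ i j ≈ 0#
  δ-≢ {i = i} {j} i≢j rewrite dec-false (i ≟ j) i≢j = refl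

  Σ-δ : ∀ {k} (i : Fin k) (f : Fin k → Carrier) → Σ' (λ j → δ i j * f j) ≈ f i
  Σ-δ {suc k} zero f = trans (+-cong (*-identityˡ _) (Σ-zero {k} λ j → zeroˡ _)) (+-identityʳ _)
  Σ-δ (suc i) f = trans (+-cong (zeroˡ _) (Σ-δ i (f ∘ suc))) (+-identityˡ _)

-- Independent rows

module RowParts (ℝ : Reals) where
  open Reals ℝ
  open RealOps ℝ
  open Rigidity ℝ
  open RealFacts ℝ
  open import Relation.Binary.Reasoning.Setoid setoid

  Independent : ∀ {k} {C : Set} → (Fin k → C → Carrier) → Set
  Independent M = IndependentRows M id

  module _ {k : ℕ} {C : Set} where

    -- `wlem` decides independence up to double negation, which stability of `c i ≈ 0#` then
    -- removes.
    independent? : (M : Fin k → C → Carrier) → Dec (Independent M)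
    independent? M with wlem (Independent M)
    ... | inj₁ ¬ind = no ¬ind
    ... | inj₂ ¬¬ind = yes λ c rel i → ≈0-stable λ ci≉0 → ¬¬ind λ ind → ci≉0 (ind c rel i)

    independent-permute : (M : Fin k → C → Carrier) {π : Fin k → Fin k} → Injective _≡_ _≡_ π →
                          IndependentRows M π → Independent M
    independent-permute M {π} π-inj ind c rel i with injective⇒surjective π-inj i
    ... | j , ≡.refl = ind (c ∘ π) (λ col →
      trans (sym (Σ-permute (λ i → c i * M i col) π-inj)) (rel col)) j

    -- A zero row would admit the unit vector `δ i` as a relation.
    nonzero-row : {M : Fin k → C → Carrier} → Independent M → ∀ i → ¬ (∀ col → M i col ≈ 0#)
    nonzero-row {M} ind i Mi≈0 = nontrivial (sym (trans (sym (δ-refl i))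
      (ind (δ i) (λ col → trans (Σ-δ i (λ j → M j col)) (Mi≈0 col)) i)))

    -- A relation of `N` with coefficient zero at `i` is also one of `M`, hence trivial. So a
    -- nontrivial relation can be divided by its coefficient at `i`. Mere failure of independence
    -- yields the relation only under double negation.
    dependence-through : {M N : Fin k → C → Carrier} (i : Fin k) → (∀ j → j ≢ i → ∀ col → N j col ≈ M j col) →
      Independent M → ¬ Independent N →
      ¬ ¬ (∃[ c ] (c i ≈ 1# × (∀ col → Σ' (λ j → c j * N j col) ≈ 0#)))
    dependence-through {M} {N} i N≈M indM ¬indN ∄c = ¬indN λ c rel j → ≈0-stable λ cj≉0 →
      let
        same : c i ≈ 0# → ∀ col j → c j * M j col ≈ c j * N j col
        same ci≈0 col j = case j ≟ i of λ
          { (yes ≡.refl) → trans (trans (*-congʳ ci≈0) (zeroˡ _)) (sym (trans (*-congʳ ci≈0) (zeroˡ _)))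
          ; (no j≢i) → *-congˡ (sym (N≈M j j≢i col)) }
        ci≉0 : ¬ (c i ≈ 0#)
        ci≉0 ci≈0 = cj≉0 (indM c (λ col → trans (Σ-cong {k} (same ci≈0 col)) (rel col)) j)
        y , ci*y≈1 = inverse (c i) ci≉0
      in ∄c ((λ j → y * c j) , trans (*-comm y (c i)) ci*y≈1 , λ col → begin
        Σ' (λ j → y * c j * N j col)   ≈⟨ Σ-cong {k} (λ j → *-assoc y (c j) (N j col)) ⟩
        Σ' (λ j → y * (c j * N j col)) ≈⟨ Σ-*ˡ y (λ j → c j * N j col) ⟩
        y * Σ' (λ j → c j * N j col)   ≈⟨ *-congˡ (rel col) ⟩
        y * 0#                         ≈⟨ zeroʳ y ⟩
        0#                             ∎)

    -- If every replacement made the rows dependent, each part of row i would lie in the span of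
    -- the other rows, and hence so would row i itself.
    split-row : ∀ {m} {M : Fin k → C → Carrier} (N : Fin m → Fin k → C → Carrier) (i : Fin k) →
      (∀ col → M i col ≈ Σ' (λ κ → N κ i col)) → (∀ κ j → j ≢ i → ∀ col → N κ j col ≈ M j col) →
      Independent M → ∃[ κ ] Independent (N κ)
    split-row {m} {M} N i M≈ΣN N≈M ind with any? (λ κ → independent? (N κ))
    ... | yes found = found
    ... | no none = contradiction
      -- There are finitely many parts, so the double negation can be moved outside the quantifier
      -- over `κ`.
      (sequence (RawMonad.rawApplicative ¬¬-Monad)
        λ κ → dependence-through i (N≈M κ) ind λ indN → none (κ , indN))
      λ ¬all → ¬all impossible
      where
      impossible : ¬ (∀ κ → ∃[ c ] (c i ≈ 1# × (∀ col → Σ' (λ j → c j * N κ j col) ≈ 0#)))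
      impossible deps = nontrivial (sym (trans (sym c-i) (ind c rel i)))
        where
        d : Fin m → Fin k → Carrier
        d κ = proj₁ (deps κ)
        c : Fin k → Carrier
        -- The relations are added up over `κ`. All have coefficient 1 at `i`, so the parts there
        -- add up to row `i` of `M` with coefficient 1; elsewhere the rows agree and the
        -- coefficients add.
        c j = if does (j ≟ i) then 1# else Σ' (λ κ → d κ j)
        c-i : c i ≈ 1#
        c-i rewrite dec-true (i ≟ i) ≡.refl = refl
        term : ∀ col j → c j * M j col ≈ Σ' (λ κ → d κ j * N κ j col)
        term col j with j ≟ i
        ... | yes ≡.refl = begin
          1# * M j col                   ≈⟨ *-identityˡ _ ⟩
          M j col                        ≈⟨ M≈ΣN col ⟩
          Σ' (λ κ → N κ j col)           ≈⟨ Σ-cong {m} (λ κ → trans (*-congʳ (proj₁ (proj₂ (deps κ)))) (*-identityˡ _)) ⟨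
          Σ' (λ κ → d κ j * N κ j col)   ∎
        ... | no j≢i = begin
          Σ' (λ κ → d κ j) * M j col     ≈⟨ Σ-*ʳ (M j col) (λ κ → d κ j) ⟨
          Σ' (λ κ → d κ j * M j col)     ≈⟨ Σ-cong {m} (λ κ → *-congˡ (N≈M κ j j≢i col)) ⟨
          Σ' (λ κ → d κ j * N κ j col)   ∎
        rel : ∀ col → Σ' (λ j → c j * M j col) ≈ 0#
        rel col = begin
          Σ' (λ j → c j * M j col)                   ≈⟨ Σ-cong {k} (term col) ⟩
          Σ' (λ j → Σ' (λ κ → d κ j * N κ j col))    ≈⟨ Σ-comm (λ j κ → d κ j * N κ j col) ⟩
          Σ' (λ κ → Σ' (λ j → d κ j * N κ j col))    ≈⟨ Σ-zero {m} (λ κ → proj₂ (proj₂ (deps κ)) col) ⟩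
          0#                                         ∎

  -- Assigning each row to a block of columns

  -- Here `nothing` marks an undecided position. Positions are decided from left to right, and each
  -- decided head is absorbed into the predicate.
  choose-all : ∀ {k} {A : Set} (Q : Vec (Maybe A) k → Set) →
    (∀ t i → lookup t i ≡ nothing → Q t → ∃[ a ] Q (t [ i ]≔ just a)) →
    Q (replicate k nothing) → ∃[ s ] Q (map just s)
  choose-all {zero} Q choose q = [] , q
  choose-all {suc k} Q choose q with choose _ zero ≡.refl q
  ... | a , q′ with choose-all (λ t → Q (just a ∷ t)) (λ t i → choose (just a ∷ t) (suc i)) q′
  ...   | s , q″ = a ∷ s , q″

  module _ {m : ℕ} {C : Set} (block : C → Fin m) where

    restrict : Fin m → (C → Carrier) → C → Carrier
    restrict κ r col = if does (block col ≟ κ) then r col else 0#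

    restrict-∈ : ∀ {κ} r col → block col ≡ κ → restrict κ r col ≈ r col
    restrict-∈ {κ} r col eq rewrite dec-true (block col ≟ κ) eq = refl

    restrict-∉ : ∀ {κ} r col → block col ≢ κ → restrict κ r col ≈ 0#
    restrict-∉ {κ} r col neq rewrite dec-false (block col ≟ κ) neq = refl

    Σ-restrict : ∀ r col → r col ≈ Σ' (λ κ → restrict κ r col)
    Σ-restrict r col = sym (trans (Σ-cong {m} term) (Σ-δ (block col) (λ _ → r col)))
      where
      term : ∀ κ → restrict κ r col ≈ δ (block col) κ * r col
      term κ with does (block col ≟ κ)
      ... | true = sym (*-identityˡ _)
      ... | false = sym (zeroˡ _)

    partOf : Maybe (Fin m) → (C → Carrier) → C → Carrier
    partOf nothing r = r
    partOf (just κ) r = restrict κ r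

    -- This selects a nonzero term in the Laplace expansion of a determinant along blocks of
    -- columns, one row at a time.
    choose-blocks : ∀ {k} (M : Fin k → C → Carrier) → Independent M →
                    ∃[ t ] Independent (λ i → restrict (t i) (M i))
    choose-blocks {k} M ind with choose-all (λ t → Independent (λ i → partOf (lookup t i) (M i))) choose initial
      where
      choose : ∀ t i → lookup t i ≡ nothing → Independent (λ j → partOf (lookup t j) (M j)) →
               ∃[ κ ] Independent (λ j → partOf (lookup (t [ i ]≔ just κ) j) (M j))
      choose t i raw = split-row (λ κ j → partOf (lookup (t [ i ]≔ just κ) j) (M j)) i splits same
        where
        splits : ∀ col → partOf (lookup t i) (M i) col ≈ Σ' (λ κ → partOf (lookup (t [ i ]≔ just κ) i) (M i) col)
        splits col rewrite raw = trans (Σ-restrict (M i) col)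
          (Σ-cong {m} λ κ → reflexive (≡.cong (λ s → partOf s (M i) col) (≡.sym (lookup∘update i t (just κ)))))
        same : ∀ κ j → j ≢ i → ∀ col →
               partOf (lookup (t [ i ]≔ just κ) j) (M j) col ≈ partOf (lookup t j) (M j) col
        same κ j j≢i col = reflexive (≡.cong (λ s → partOf s (M j) col) (lookup∘update′ j≢i t (just κ)))
      initial : Independent (λ i → partOf (lookup (replicate k nothing) i) (M i))
      initial c rel = ind c λ col → trans
        (Σ-cong {k} λ i → reflexive (≡.cong (λ s → c i * partOf s (M i) col) (≡.sym (lookup-replicate i nothing))))
        (rel col)
    ... | s , ind′ = lookup s , λ c rel → ind′ c λ col → trans
      (Σ-cong {k} λ i → reflexive (≡.cong (λ x → c i * partOf x (M i) col) (lookup-map i just s)))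
      (rel col)

-- Edge sets whose incidence vectors are independent

module Incidence (ℝ : Reals) {n k : ℕ} (G : OrbitGraph n k) where
  open Reals ℝ
  open RealOps ℝ
  open RealFacts ℝ
  open OrbitGraph G
  open import Relation.Binary.Reasoning.Setoid setoid

  incidence : Fin k → Fin n → Carrier
  incidence e v = δ v (src e) - δ v (tgt e)

  SupportedOn : (Fin k → Bool) → (Fin k → Carrier) → Set
  SupportedOn S b = ∀ e → S e ≡ false → b e ≈ 0#

  -- Edge coefficients are viewed as 1-chains, with boundary source minus target.
  Boundary : (Fin k → Carrier) → (Fin n → Carrier) → Set
  Boundary b ∂b = ∀ v → Σ' (λ e → b e * incidence e v) ≈ ∂b v

  boundary-+ : ∀ {b b′ ∂b ∂b′} → Boundary b ∂b → Boundary b′ ∂b′ →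
               Boundary (λ e → b e + b′ e) (λ v → ∂b v + ∂b′ v)
  boundary-+ {b} {b′} p q v = trans (Σ-cong {k} λ e → distribʳ (incidence e v) (b e) (b′ e))
    (trans (Σ-+ (λ e → b e * incidence e v) (λ e → b′ e * incidence e v)) (+-cong (p v) (q v)))

  boundary-* : ∀ {b ∂b} x → Boundary b ∂b → Boundary (λ e → x * b e) (λ v → x * ∂b v)
  boundary-* {b} x p v = trans (Σ-cong {k} λ e → *-assoc x (b e) (incidence e v))
    (trans (Σ-*ˡ x (λ e → b e * incidence e v)) (*-congˡ (p v)))

  boundary-δ : ∀ e → Boundary (δ e) (incidence e)
  boundary-δ e v = Σ-δ e (λ e → incidence e v)

  -- The witness is the sum of the signed edges of the walk.
  walk-boundary : ∀ {P a b} → Path G P a b →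
                  ∃[ c ] (SupportedOn P c × Boundary c (λ v → δ v a - δ v b))
  walk-boundary {a = a} here = (λ _ → 0#) , (λ _ _ → refl) , λ v →
    trans (Σ-zero {k} λ e → zeroˡ (incidence e v)) (sym (-‿inverseʳ (δ v a)))
  walk-boundary {P} {a} {b} (step {w = w} e e∈P j p) with walk-boundary p
  ... | c , supp , ∂c = (λ f → σ * δ e f + c f) , supp′ , λ v → trans
      (boundary-+ (boundary-* σ (boundary-δ e)) ∂c v)
      (trans (+-cong (proj₂ (sign j) v) refl) (telescope (δ v a) (δ v w) (δ v b)))
    where
    sign : ∀ {a w} → Joins G e a w → ∃[ σ ] (∀ v → σ * incidence e v ≈ δ v a - δ v w)
    sign (inj₁ (≡.refl , ≡.refl)) = 1# , λ v → *-identityˡ _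
    sign (inj₂ (≡.refl , ≡.refl)) = - 1# , λ v → trans (-1*x≈-x _) (⁻¹-anti-homo‿- _ _)
    σ : Carrier
    σ = proj₁ (sign j)
    telescope : ∀ x y z → (x - y) + (y - z) ≈ x - z
    telescope x y z = trans (+-assoc x (- y) (y - z)) (+-congˡ (trans (sym (+-assoc (- y) y (- z)))
      (trans (+-congʳ (-‿inverseˡ y)) (+-identityˡ (- z)))))
    supp′ : SupportedOn P (λ f → σ * δ e f + c f)
    supp′ f f∉P = trans (+-cong (trans (*-congˡ (δ-≢ e≢f)) (zeroʳ σ)) (supp f f∉P)) (+-identityˡ 0#)
      where
      e≢f : e ≢ f
      e≢f ≡.refl = case ≡.trans (≡.sym e∈P) f∉P of λ ()

  IndependentEdges : (Fin k → Bool) → Set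
  IndependentEdges S = ∀ b → SupportedOn S b → Boundary b (λ _ → 0#) → ∀ e → b e ≈ 0#

  -- Subtracting the chain of a bypassing walk from `δ e` leaves a chain in `S` with zero boundary.
  -- Its coefficient at `e` is 1, because the walk avoids `e`.
  independentEdges⇒forest : ∀ {S} → IndependentEdges S → Forest G S
  independentEdges⇒forest {S} ind e P e∈S e∉P P⊆S p with walk-boundary p
  ... | c , supp , ∂c = nontrivial (begin
      0#                     ≈⟨ ind b supp′ ∂b≈0 e ⟨
      δ e e + - 1# * c e     ≈⟨ +-cong (δ-refl e) (*-congˡ (supp e e∉P)) ⟩
      1# + - 1# * 0#         ≈⟨ +-congˡ (zeroʳ (- 1#)) ⟩
      1# + 0#                ≈⟨ +-identityʳ 1# ⟩
      1#                     ∎)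
    where
    b : Fin k → Carrier
    b f = δ e f + - 1# * c f
    supp′ : SupportedOn S b
    supp′ f f∉S = trans (+-cong (δ-≢ e≢f) (trans (*-congˡ (supp f f∉P)) (zeroʳ _))) (+-identityˡ 0#)
      where
      e≢f : e ≢ f
      e≢f ≡.refl = case ≡.trans (≡.sym e∈S) f∉S of λ ()
      f∉P : P f ≡ false
      f∉P = ¬-not λ f∈P → case ≡.trans (≡.sym (P⊆S f f∈P)) f∉S of λ ()
    ∂b≈0 : Boundary b (λ _ → 0#)
    ∂b≈0 v = trans (boundary-+ (boundary-δ e) (boundary-* (- 1#) ∂c) v)
      (trans (+-congˡ (-1*x≈-x _)) (-‿inverseʳ _))

-- Edge classes of the rigidity matrix

block : ∀ {n} → Col n → Fin 3
block (inj₁ (_ , c)) = inject₁ c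
block (inj₂ tt) = fromℕ 2

coordinate≢lattice : (c : Fin 2) → inject₁ c ≢ fromℕ 2
coordinate≢lattice c eq = fromℕ≢inject₁ (≡.sym eq)

class : ∀ {k} → (Fin k → Fin 3) → Fin 3 → Fin k → Bool
class t κ e = does (t e ≟ κ)

∈class : ∀ {k} (t : Fin k → Fin 3) {κ e} → class t κ e ≡ true → t e ≡ κ
∈class t {κ} {e} e∈ with t e ≟ κ
... | yes te≡κ = te≡κ

count-classes : ∀ {k} (t : Fin k → Fin 3) →
  count (class t (# 0)) ℕ.+ count (class t (# 1)) ℕ.+ count (class t (# 2)) ≡ k
count-classes {zero} t = ≡.refl
count-classes {suc k} t with t zero | count-classes (t ∘ suc)
... | zero | ih = ≡.cong suc ih
... | suc zero | ih = ≡.trans (≡.cong (ℕ._+ count (class (t ∘ suc) (# 2))) (ℕ.+-suc _ _)) (≡.cong suc ih)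
... | suc (suc zero) | ih = ≡.trans (ℕ.+-suc _ _) (≡.cong suc ih)

class-disjoint : ∀ {k} (t : Fin k → Fin 3) {κ κ′ e} → class t κ e ≡ true → κ ≢ κ′ → class t κ′ e ≡ false
class-disjoint t {e = e} e∈κ κ≢κ′ = dec-false (t e ≟ _) λ te≡κ′ → κ≢κ′ (≡.trans (≡.sym (∈class t e∈κ)) te≡κ′)

class-cases : ∀ {k} (t : Fin k → Fin 3) e →
  class t (# 0) e ≡ true ⊎ class t (# 1) e ≡ true ⊎ class t (# 2) e ≡ true
class-cases t e with t e
... | zero = inj₁ ≡.refl
... | suc zero = inj₂ (inj₁ ≡.refl)
... | suc (suc zero) = inj₂ (inj₂ ≡.refl)

module Classes (ℝ : Reals) {n k : ℕ} (G : OrbitGraph n k) (x y1 y2 : Reals.Carrier ℝ)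
               (p : Fin n → Rigidity.Point ℝ) (t : Fin k → Fin 3)
               (independent : RowParts.Independent ℝ
                 (λ e → RowParts.restrict ℝ block (t e) (Rigidity.R ℝ x y1 y2 G p e))) where
  open Reals ℝ
  open RealOps ℝ
  open Rigidity ℝ
  open RealFacts ℝ
  open RowParts ℝ
  open Incidence ℝ G
  open OrbitGraph G
  open import Relation.Binary.Reasoning.Setoid setoid

  expand : ∀ d {a b a′ b′} → d * a ≈ a′ → - (d * b) ≈ b′ → a′ + b′ ≈ d * (a - b)
  expand d {a} {b} p q = sym (trans (x[y-z]≈xy-xz d a b) (+-cong p q))

  Rₓ : Fin k → Col n → Carrier
  Rₓ = R x y1 y2 G p

  row : Fin k → Col n → Carrier
  row e = restrict block (t e) (Rₓ e)

  displacement : Fin 2 → Fin k → Carrier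
  displacement c e = coord (proj₁ (p (src e)) - (proj₁ (p (tgt e)) + proj₁ mL) ,
                      proj₂ (p (src e)) - (proj₂ (p (tgt e)) + proj₂ mL)) c
    where mL = mulL x y1 y2 (gain e)

  -- The two ends receive the same displacement with opposite signs, so it factors out; for a loop
  -- both contributions occur on each side.
  R-incidence : ∀ e v c → Rₓ e (inj₁ (v , c)) ≈ displacement c e * incidence e v
  R-incidence e v c with v ≟ src e | v ≟ tgt e
  ... | yes _ | yes _ = expand (displacement c e) (*-identityʳ _) (-‿cong (*-identityʳ _))
  ... | yes _ | no _ = expand (displacement c e) (*-identityʳ _) (trans (-‿cong (zeroʳ _)) -0#≈0#)
  ... | no _ | yes _ = expand (displacement c e) (zeroʳ _) (-‿cong (*-identityʳ _))
  ... | no _ | no _ = expand (displacement c e) (zeroʳ _) (trans (-‿cong (zeroʳ _)) -0#≈0#)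

  row-outside : ∀ {e κ} col → t e ≡ κ → block col ≢ κ → row e col ≈ 0#
  row-outside {e} col ≡.refl = restrict-∉ block (Rₓ e) col

  row-coordinate : ∀ {e c} v → t e ≡ inject₁ c → row e (inj₁ (v , c)) ≈ displacement c e * incidence e v
  row-coordinate {e} {c} v te≡c =
    trans (restrict-∈ block (Rₓ e) (inj₁ (v , c)) (≡.sym te≡c)) (R-incidence e v c)

  block-coordinate : ∀ {c} (Q : Col n → Set) → (∀ v → Q (inj₁ (v , c))) →
                     (∀ col → block col ≢ inject₁ c → Q col) → ∀ col → Q col
  block-coordinate {c} Q inside outside col with block col ≟ inject₁ c
  ... | no col∉c = outside col col∉c
  block-coordinate Q inside outside (inj₁ (v , c)) | yes eq with inject₁-injective eq
  ... | ≡.refl = inside v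
  block-coordinate Q inside outside (inj₂ tt) | yes eq = contradiction eq fromℕ≢inject₁

  -- Otherwise the restricted row would vanish inside its block as well as outside it.
  displacement-nonzero : ∀ {e c} → t e ≡ inject₁ c → ¬ (displacement c e ≈ 0#)
  displacement-nonzero {e} {c} te≡c d≈0 = nonzero-row {M = row} independent e
    (block-coordinate (λ col → row e col ≈ 0#)
      (λ v → trans (row-coordinate v te≡c) (trans (*-congʳ d≈0) (zeroˡ _)))
      (λ col → row-outside col te≡c))

  -- Within the class, the rows are incidence vectors scaled by nonzero displacements. Dividing the
  -- coefficients by these turns a relation of incidence vectors into one of rows.
  coordinate-independent : ∀ c → IndependentEdges (class t (inject₁ c))
  coordinate-independent c b supp ∂b≈0 = b≈0
    where
    S : Fin k → Bool
    S = class t (inject₁ c)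
    1/displacement : ∀ e → ∃[ y ] (S e ≡ true → displacement c e * y ≈ 1#)
    1/displacement e with t e ≟ inject₁ c
    ... | yes te≡c = let y , d*y≈1 = inverse (displacement c e) (displacement-nonzero te≡c) in y , λ _ → d*y≈1
    -- Outside the class any value would do, since `b` vanishes there.
    ... | no _ = 0# , λ ()
    y : Fin k → Carrier
    y e = proj₁ (1/displacement e)
    by-membership : ∀ e {A : Set} → (S e ≡ true → A) → (b e ≈ 0# → A) → A
    by-membership e inside outside with S e in eq
    ... | true = inside ≡.refl
    ... | false = outside (supp e eq)
    vanish : ∀ e z → b e ≈ 0# → b e * y e * z ≈ 0#
    vanish e z be≈0 = trans (*-congʳ (trans (*-congʳ be≈0) (zeroˡ _))) (zeroˡ _)
    unscale : ∀ e z → S e ≡ true → b e * y e * (displacement c e * z) ≈ b e * z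
    unscale e z e∈S = begin
      b e * y e * (displacement c e * z)   ≈⟨ *-assoc (b e) (y e) (displacement c e * z) ⟩
      b e * (y e * (displacement c e * z)) ≈⟨ *-congˡ (*-assoc (y e) (displacement c e) z) ⟨
      b e * (y e * displacement c e * z)   ≈⟨ *-congˡ (*-congʳ (trans (*-comm (y e) (displacement c e)) (proj₂ (1/displacement e) e∈S))) ⟩
      b e * (1# * z)                 ≈⟨ *-congˡ (*-identityˡ z) ⟩
      b e * z                        ∎
    inside : ∀ v e → b e * y e * row e (inj₁ (v , c)) ≈ b e * incidence e v
    inside v e = by-membership e
      (λ e∈S → trans (*-congˡ (row-coordinate v (∈class t e∈S))) (unscale e (incidence e v) e∈S))
      (λ be≈0 → trans (vanish e _ be≈0) (sym (trans (*-congʳ be≈0) (zeroˡ _))))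
    outside : ∀ col → block col ≢ inject₁ c → ∀ e → b e * y e * row e col ≈ 0#
    outside col col∉c e = by-membership e
      (λ e∈S → trans (*-congˡ (row-outside col (∈class t e∈S) col∉c)) (zeroʳ _))
      (vanish e _)
    scaled≈0 : ∀ e → b e * y e ≈ 0#
    scaled≈0 = independent (λ e → b e * y e) (block-coordinate _
      (λ v → trans (Σ-cong {k} (inside v)) (∂b≈0 v))
      (λ col col∉c → Σ-zero {k} (outside col col∉c)))
    b≈0 : ∀ e → b e ≈ 0#
    b≈0 e = by-membership e
      (λ e∈S → begin
        b e                             ≈⟨ *-identityʳ (b e) ⟨
        b e * 1#                        ≈⟨ unscale e 1# e∈S ⟨
        b e * y e * (displacement c e * 1#)   ≈⟨ *-congʳ (scaled≈0 e) ⟩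
        0# * (displacement c e * 1#)          ≈⟨ zeroˡ _ ⟩
        0#                              ∎)
      id

  coordinate-forest : ∀ c → Forest G (class t (inject₁ c))
  coordinate-forest c = independentEdges⇒forest (coordinate-independent c)

  -- Two rows supported in one common column are proportional: `ℓ f` times row `e` equals `ℓ e`
  -- times row `f`. Independence forces `ℓ e` to be zero, which makes row `e` a zero row.
  lattice-unique : ∀ e f → class t (# 2) e ≡ true → class t (# 2) f ≡ true → e ≡ f
  lattice-unique e f e∈L f∈L with e ≟ f
  ... | yes e≡f = e≡f
  ... | no e≢f = contradiction zero-row (nonzero-row {M = row} independent e)
    where
    ℓ : Fin k → Carrier
    ℓ g = row g (inj₂ tt)
    b : Fin k → Carrier
    b g = (δ e g * ℓ f) - (δ f g * ℓ e)
    rel : ∀ col → (ℓ f * row e col) - (ℓ e * row f col) ≈ 0#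
    rel (inj₁ (v , c)) = trans (+-cong
      (trans (*-congˡ (row-outside (inj₁ (v , c)) (∈class t e∈L) (coordinate≢lattice c))) (zeroʳ _))
      (trans (-‿cong (trans (*-congˡ (row-outside (inj₁ (v , c)) (∈class t f∈L) (coordinate≢lattice c))) (zeroʳ _))) -0#≈0#))
      (+-identityˡ 0#)
    rel (inj₂ tt) = trans (+-congʳ (*-comm (ℓ f) (ℓ e))) (-‿inverseʳ _)
    term : ∀ col g → b g * row g col ≈ ℓ f * (δ e g * row g col) + - ℓ e * (δ f g * row g col)
    term col g = trans (distribʳ (row g col) _ _) (+-cong
      (trans (*-congʳ (*-comm (δ e g) (ℓ f))) (*-assoc _ _ _))
      (trans (*-congʳ (trans (-‿cong (*-comm (δ f g) (ℓ e))) (-‿distribˡ-* (ℓ e) (δ f g)))) (*-assoc _ _ _)))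
    combination : ∀ col → Σ' (λ g → b g * row g col) ≈ 0#
    combination col = begin
      Σ' (λ g → b g * row g col)
        ≈⟨ Σ-cong {k} (term col) ⟩
      Σ' (λ g → ℓ f * (δ e g * row g col) + - ℓ e * (δ f g * row g col))
        ≈⟨ Σ-+ (λ g → ℓ f * (δ e g * row g col)) (λ g → - ℓ e * (δ f g * row g col)) ⟩
      Σ' (λ g → ℓ f * (δ e g * row g col)) + Σ' (λ g → - ℓ e * (δ f g * row g col))
        ≈⟨ +-cong (Σ-*ˡ (ℓ f) (λ g → δ e g * row g col)) (Σ-*ˡ (- ℓ e) (λ g → δ f g * row g col)) ⟩
      ℓ f * Σ' (λ g → δ e g * row g col) + - ℓ e * Σ' (λ g → δ f g * row g col)
        ≈⟨ +-cong (*-congˡ (Σ-δ e (λ g → row g col))) (*-congˡ (Σ-δ f (λ g → row g col))) ⟩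
      ℓ f * row e col + - ℓ e * row f col
        ≈⟨ +-congˡ (-‿distribˡ-* (ℓ e) (row f col)) ⟨
      (ℓ f * row e col) - (ℓ e * row f col)
        ≈⟨ rel col ⟩
      0# ∎
    -- At `f` the coefficient of the relation is `0# - ℓ e`.
    ℓe≈0 : ℓ e ≈ 0#
    ℓe≈0 = begin
      ℓ e                                  ≈⟨ -‿involutive (ℓ e) ⟨
      - - ℓ e                              ≈⟨ -‿cong (+-identityˡ (- ℓ e)) ⟨
      - (0# - ℓ e)                         ≈⟨ -‿cong (+-cong (trans (*-congʳ (δ-≢ e≢f)) (zeroˡ (ℓ f)))
                                                (-‿cong (trans (*-congʳ (δ-refl f)) (*-identityˡ (ℓ e))))) ⟨
      - ((δ e f * ℓ f) - (δ f f * ℓ e))    ≈⟨ -‿cong (independent b combination f) ⟩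
      - 0#                                 ≈⟨ -0#≈0# ⟩
      0#                                   ∎
    zero-row : ∀ col → row e col ≈ 0#
    zero-row (inj₁ (v , c)) = row-outside (inj₁ (v , c)) (∈class t e∈L) (coordinate≢lattice c)
    zero-row (inj₂ tt) = ℓe≈0

-- Edge count and conclusion

-- Both forests have at most n - 1 edges and there is at most one lattice edge, so 2n - 1 edges
-- leave no slack.
tight : ∀ {n a b l m m′} → 1 ℕ.≤ m → 1 ℕ.≤ m′ → l ℕ.≤ 1 → m ℕ.+ a ≡ n → m′ ℕ.+ b ≡ n →
        suc (a ℕ.+ b ℕ.+ l) ≡ 2 ℕ.* n → m ≡ 1 × m′ ≡ 1 × l ≡ 1
tight {n} {a} {b} {l} {suc m} {suc m′} _ _ l≤1 m+a≡n m′+b≡n total = conclude m m′ l≤1 balance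
  where
  open +-*-Solver
  -- The label counts are `suc m` and `suc m′`; adding the two forest equations and cancelling
  -- against the total leaves this, so `l ≤ 1` forces `m` and `m′` to be zero.
  balance : l ≡ suc (m ℕ.+ m′)
  balance = ℕ.+-cancelˡ-≡ (suc (a ℕ.+ b)) _ _ (≡.trans total (≡.trans
    (≡.cong₂ ℕ._+_ (≡.sym m+a≡n) (≡.trans (ℕ.+-identityʳ n) (≡.sym m′+b≡n)))
    (solve 4 (λ a b m m′ → (con 1 :+ m :+ a) :+ (con 1 :+ m′ :+ b) :=
                           con 1 :+ (a :+ b) :+ (con 1 :+ (m :+ m′))) ≡.refl a b m m′)))
  conclude : ∀ {l} m m′ → l ℕ.≤ 1 → l ≡ suc (m ℕ.+ m′) → suc m ≡ 1 × suc m′ ≡ 1 × l ≡ 1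
  conclude zero zero _ ≡.refl = ≡.refl , ≡.refl , ≡.refl
  conclude zero (suc m′) (s≤s ()) ≡.refl
  conclude (suc m) m′ (s≤s ()) ≡.refl

forests⇒tree-and-map-graph : ∀ {n k} (G : OrbitGraph n k) (t : Fin k → Fin 3) → suc k ≡ 2 ℕ.* n →
  Forest G (class t (# 0)) → Forest G (class t (# 1)) →
  (∀ e f → class t (# 2) e ≡ true → class t (# 2) f ≡ true → e ≡ f) →
  ∃[ T ] ∃[ M ] ((∀ e → M e ≡ not (T e)) × SpanningTree G T × ConnectedSpanningMapGraph G M)
forests⇒tree-and-map-graph {n} {k} G t 1+k≡2n forestT forestB L-unique = T , M , (λ _ → ≡.refl) ,
  (connected componentsT mT≡1 , forest-acyclic G forestT) ,
  tree+edge-mapGraph G forestB (connected componentsB mB≡1) B⊆M e₀∈M e₀∉B M⊆B+e₀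
  where
  T B L M : Fin k → Bool
  T = class t (# 0)
  B = class t (# 1)
  L = class t (# 2)
  M e = not (T e)

  componentsT : Components G T
  componentsT = forest-components G T forestT
  componentsB : Components G B
  componentsB = forest-components G B forestB

  connected : ∀ {S} (c : Components G S) → proj₁ c ≡ 1 → Connected G S
  connected (_ , f , _ , conn) ≡.refl u v = conn (Fin1 (f u) (f v))
    where
    Fin1 : (i j : Fin 1) → i ≡ j
    Fin1 zero zero = ≡.refl

  nonempty : ∀ {m} → Fin m → 1 ℕ.≤ m
  nonempty {suc _} _ = s≤s z≤n
  -- Since `suc k` is positive, so is `n`; a vertex then shows that each labelling has at least one
  -- label.
  vertex : Fin n
  vertex = inhabitant 1+k≡2n
    where
    inhabitant : ∀ {n} → suc k ≡ 2 ℕ.* n → Fin n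
    inhabitant {suc n} _ = zero

  sizes : proj₁ componentsT ≡ 1 × proj₁ componentsB ≡ 1 × count L ≡ 1
  sizes = tight (nonempty (proj₁ (proj₂ componentsT) vertex)) (nonempty (proj₁ (proj₂ componentsB) vertex))
    (count-≤1 L L-unique) (proj₁ (proj₂ (proj₂ componentsT))) (proj₁ (proj₂ (proj₂ componentsB)))
    (≡.trans (≡.cong suc (count-classes t)) 1+k≡2n)
  mT≡1 : proj₁ componentsT ≡ 1
  mT≡1 = proj₁ sizes
  mB≡1 : proj₁ componentsB ≡ 1
  mB≡1 = proj₁ (proj₂ sizes)

  L-edge : ∃[ e ] L e ≡ true
  L-edge = count-member L (ℕ.≤-reflexive (≡.sym (proj₂ (proj₂ sizes))))
  e₀ : Fin k
  e₀ = proj₁ L-edge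
  e₀∈L : L e₀ ≡ true
  e₀∈L = proj₂ L-edge
  e₀∉B : B e₀ ≡ false
  e₀∉B = class-disjoint t e₀∈L λ ()
  e₀∈M : M e₀ ≡ true
  e₀∈M = ≡.cong not (class-disjoint t e₀∈L λ ())
  B⊆M : B ⊆ M
  B⊆M e e∈B = ≡.cong not (class-disjoint t e∈B λ ())
  M⊆B+e₀ : ∀ e → M e ≡ true → e ≢ e₀ → B e ≡ true
  M⊆B+e₀ e e∈M e≢e₀ with class-cases t e
  ... | inj₁ e∈T = case ≡.trans (≡.sym e∈M) (≡.cong not e∈T) of λ ()
  ... | inj₂ (inj₁ e∈B) = e∈B
  ... | inj₂ (inj₂ e∈L) = contradiction (L-unique e e₀ e∈L e₀∈L) e≢e₀

theorem3p3 : (ℝ : Reals) → Theorem3p3 ℝ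
theorem3p3 ℝ {n} {k} G x y1 y2 p (1+k≡2n , (f , f-inj , f-ind) , _)
  with RowParts.choose-blocks ℝ block (Rigidity.R ℝ x y1 y2 G p)
         (reindex (≡.cong ℕ.pred (≡.sym 1+k≡2n)) f f-inj f-ind)
  where
  Rₓ = Rigidity.R ℝ x y1 y2 G p
  -- The rank 2n - 1 is the number of rows, so the independent family enumerates all of them in some
  -- order.
  reindex : ∀ {r} → r ≡ k → (f : Fin r → Fin k) → Injective _≡_ _≡_ f →
            Rigidity.IndependentRows ℝ Rₓ f → RowParts.Independent ℝ Rₓ
  reindex ≡.refl f f-inj = RowParts.independent-permute ℝ Rₓ f-inj
... | t , ind = forests⇒tree-and-map-graph G t 1+k≡2n
    (coordinate-forest (# 0)) (coordinate-forest (# 1)) lattice-unique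
  where open Classes ℝ G x y1 y2 p t ind
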